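{- Let $n\ge 2$. Every $2$-layer $4$-planar graph on $n$ vertices has at most $2n-3$ edges.
   Context: All graphs are finite and simple (no loops or parallel edges). A topological $2$-layer graph is a bipartite graph $G=(U\,\dot\cup\,V,E)$, $E\subseteq U\times V$, drawn in the plane so that the vertices of $U$ and of $V$ are distinct points on two horizontal lines $L_u$ and $L_v$, respectively, and edges are $y$-monotone Jordan arcs; the drawing is assumed simple, i.e. adjacent edges do not cross and independent edges cross at most once. Denote the vertices by $u_1,\dots,u_p$ along $L_u$ and $v_1,\dots,v_q$ along $L_v$ in left-to-right order, $n=p+q$. (Thus edges $(u_i,v_x)$ and $(u_j,v_y)$ with $i<j$ cross if and only if $x>y$.) A topological $2$-layer graph is $k$-planar if each edge is crossed at most $k$ times. A bipartite graph is $2$-layer $k$-planar if it is isomorphic to the underlying abstract graph of some topological $2$-layer $k$-planar graph. -}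

module Defs where

open import Data.Empty using (⊥)
open import Data.Fin using (Fin; _<_)
open import Data.Fin.Properties using (_<?_)
open import Data.List using (List; allFin; cartesianProduct; filter; length)
open import Data.Nat using (ℕ; _≤_)
open import Data.Product using (_×_; _,_; Σ-syntax; ∃₂)
open import Data.Sum using (_⊎_; inj₁; inj₂)
open import Function.Bundles using (_↔_; _⇔_; Inverse)
open import Level using (0ℓ)
open import Relation.Binary.Core using (REL; Rel)
open import Relation.Binary.Definitions using (Decidable; Symmetric)
open import Relation.Nullary using (¬_; no; _×-dec_; _⊎-dec_)

record Graph (V : Set) : Set₁ where
  field
    Adj    : Rel V 0ℓ
    adj?   : Decidable Adj
    sym    : Symmetric Adj
    irrefl : ∀ {v} → ¬ Adj v v

-- An edge {a , b} is listed once, as the pair with a < b.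
edges : ∀ {n} → Graph (Fin n) → List (Fin n × Fin n)
edges {n} G =
  filter (λ { (a , b) → (a <? b) ×-dec Graph.adj? G a b })
         (cartesianProduct (allFin n) (allFin n))

edgeCount : ∀ {n} → Graph (Fin n) → ℕ
edgeCount G = length (edges G)

_≅_ : ∀ {V W : Set} → Graph V → Graph W → Set
_≅_ {V} {W} G H =
  Σ[ f ∈ V ↔ W ] (∀ a b → Graph.Adj G a b ⇔ Graph.Adj H (Inverse.to f a) (Inverse.to f b))

-- A topological 2-layer graph, up to the information that determines which
-- edges cross: u₁, …, u_p and v₁, …, v_q are indexed by Fin p and Fin q in
-- left-to-right order along their lines.  As the arcs are y-monotone and the
-- drawing is simple, two edges cross at most once, and whether they do depends
-- only on the order of their endpoints (see Cross).  Conversely, straight-line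
-- segments realise every such order.
record TwoLayer (p q : ℕ) : Set₁ where
  field
    E  : REL (Fin p) (Fin q) 0ℓ
    e? : Decidable E

module _ {p q : ℕ} where

  -- The two disjuncts make the relation symmetric; edges sharing an endpoint
  -- never cross.
  Cross : Rel (Fin p × Fin q) 0ℓ
  Cross (i , x) (j , y) = (i < j × y < x) ⊎ (j < i × x < y)

  cross? : Decidable Cross
  cross? (i , x) (j , y) = ((i <? j) ×-dec (y <? x)) ⊎-dec ((j <? i) ×-dec (x <? y))

  drawnEdges : TwoLayer p q → List (Fin p × Fin q)
  drawnEdges D =
    filter (λ { (i , x) → TwoLayer.e? D i x }) (cartesianProduct (allFin p) (allFin q))

  crossings : TwoLayer p q → Fin p × Fin q → ℕ
  crossings D e = length (filter (cross? e) (drawnEdges D))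

  IsPlanar : ℕ → TwoLayer p q → Set
  IsPlanar k D = ∀ i x → TwoLayer.E D i x → crossings D (i , x) ≤ k

  underlying : TwoLayer p q → Graph (Fin p ⊎ Fin q)
  underlying D = record
    { Adj    = Adj
    ; adj?   = adj?
    ; sym    = λ {a} {b} → sym a b
    ; irrefl = λ {v} → irrefl v
    }
    where
    open TwoLayer D

    Adj : Rel (Fin p ⊎ Fin q) 0ℓ
    Adj (inj₁ i) (inj₂ x) = E i x
    Adj (inj₂ x) (inj₁ i) = E i x
    Adj (inj₁ _) (inj₁ _) = ⊥
    Adj (inj₂ _) (inj₂ _) = ⊥

    adj? : Decidable Adj
    adj? (inj₁ i) (inj₂ x) = e? i x
    adj? (inj₂ x) (inj₁ i) = e? i x
    adj? (inj₁ _) (inj₁ _) = no λ ()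
    adj? (inj₂ _) (inj₂ _) = no λ ()

    sym : ∀ a b → Adj a b → Adj b a
    sym (inj₁ _) (inj₂ _) e = e
    sym (inj₂ _) (inj₁ _) e = e

    irrefl : ∀ v → ¬ Adj v v
    irrefl (inj₁ _) ()
    irrefl (inj₂ _) ()

-- Bipartiteness of G is implied by the isomorphism.
TwoLayerPlanar : ∀ {V : Set} → ℕ → Graph V → Set₁
TwoLayerPlanar k G =
  ∃₂ λ p q → Σ[ D ∈ TwoLayer p q ] (IsPlanar k D × G ≅ underlying D)

{-# OPTIONS --safe #-}
-- Read the drawing as a 0-1 matrix: two entries cross iff one lies strictly
-- above and to the right of the other.  Induct on the number of rows and
-- columns, deleting k of them together with at most 2k entries.  A row or column
-- with at most two entries can be deleted.  Otherwise, counting crossings near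
-- the corner of the first rows r₀ < r₁ < r₂ and columns c₀ < c₁ < c₂ shows that
-- column c₀ consists exactly of (r₀, c₀), (r₁, c₀), (r₂, c₀), that rows r₀ and r₁
-- have at most six entries together, and the same with rows and columns
-- exchanged.  If (r₁, c₁) is an entry, delete two rows and two columns with at
-- most 6 + 6 − 4 = 8 entries.  If not, column c₁ has an entry (s, c₁) with
-- s > r₂; its crossings bound the entries of rows r₀, r₁, r₂ by nine and force
-- the entry (r₂, c₁).  Symmetrically for columns, and one deletes three rows and
-- three columns with at most 9 + 9 − 6 = 12 entries.
module Submission where

open import Defs
open import Data.Bool using (true; false)
open import Data.Fin as Fin using (Fin; _<_)
open import Data.Fin.Permutation using (↔⇒≡)
import Data.Fin.Properties as Fin
open import Data.List
  using (List; []; _∷_; [_]; _++_; allFin; cartesianProduct; filter; length; map)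
import Data.List.Membership.DecPropositional as DecMembership
open import Data.List.Membership.Propositional using (_∈_; _∉_; find; lose)
open import Data.List.Membership.Propositional.Properties
open import Data.List.Properties
  using (filter-notAll; filter-≐; length-++; length-map; length-tabulate)
open import Data.List.Relation.Binary.Subset.Propositional using (_⊆_)
open import Data.List.Relation.Unary.All as All using ([]; _∷_)
open import Data.List.Relation.Unary.AllPairs as AllPairs using (AllPairs; []; _∷_)
import Data.List.Relation.Unary.AllPairs.Properties as AllPairs
open import Data.List.Relation.Unary.Any as Any using (here; there; any?)
open import Data.List.Relation.Unary.Unique.Propositional using (Unique)
import Data.List.Relation.Unary.Unique.Propositional.Properties as Unique
open import Data.Nat as ℕ using (ℕ; suc; _+_; _*_; _∸_; _≤_; z≤n; s≤s)
import Data.Nat.Properties as ℕ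
open import Data.Nat.Tactic.RingSolver using (solve-∀)
open import Data.Product using (_×_; _,_; proj₁; proj₂; swap; ∃-syntax)
open import Data.Product.Properties using (≡-dec)
open import Data.Sum as Sum using (inj₁; inj₂)
open import Function using (_∘_)
open import Function.Bundles using (Inverse; Equivalence)
open import Function.Construct.Composition using (_↔-∘_)
open import Function.Construct.Symmetry using (↔-sym)
open import Relation.Binary.PropositionalEquality
  using (_≡_; refl; sym; trans; cong; cong₂; subst; subst₂)
open import Relation.Nullary
  using (¬_; Dec; yes; no; does; contradiction; ¬?; _×-dec_; from-no)
open import Relation.Unary using (Decidable)

private
  variable
    A B : Set
    p q : ℕ

-- Counting in lists without repetition.

-- Pigeonhole: cut the head `x` out of `ys`; the tail of `xs` avoids `x`, so it lies in what is
-- left.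
unique-⊆⇒length-≤ : {xs ys : List A} → Unique xs → xs ⊆ ys → length xs ≤ length ys
unique-⊆⇒length-≤ [] _ = z≤n
unique-⊆⇒length-≤ {xs = x ∷ xs} (x∉xs ∷ xs!) xs⊆ys with ∈-∃++ (xs⊆ys (here refl))
... | as , bs , refl = begin
  suc (length xs)             ≤⟨ s≤s (unique-⊆⇒length-≤ xs! xs⊆as++bs) ⟩
  suc (length (as ++ bs))     ≡⟨ cong suc (length-++ as) ⟩
  suc (length as + length bs) ≡⟨ ℕ.+-suc (length as) (length bs) ⟨
  length as + suc (length bs) ≡⟨ length-++ as ⟨
  length (as ++ x ∷ bs)       ∎
  where
  open ℕ.≤-Reasoning
  xs⊆as++bs : xs ⊆ as ++ bs
  xs⊆as++bs z∈xs with ∈-++⁻ as (xs⊆ys (there z∈xs))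
  ... | inj₁ z∈as         = ∈-++⁺ˡ z∈as
  ... | inj₂ (here refl)  = contradiction refl (All.lookup x∉xs z∈xs)
  ... | inj₂ (there z∈bs) = ∈-++⁺ʳ as z∈bs

count : {P : A → Set} → Decidable P → List A → ℕ
count P? xs = length (filter P? xs)

module _ {P : A → Set} (P? : Decidable P) where

  count-≤ : {xs : List A} → Unique xs → ∀ ys → (∀ {e} → e ∈ xs → P e → e ∈ ys) →
            count P? xs ≤ length ys
  count-≤ {xs} xs! ys h = unique-⊆⇒length-≤ (Unique.filter⁺ P? xs!) λ e∈ →
    let e∈xs , Pe = ∈-filter⁻ P? {xs = xs} e∈ in h e∈xs Pe

  count-filter-≤ : {Q : A → Set} (Q? : Decidable Q) {xs : List A} → Unique xs →
                   count P? (filter Q? xs) ≤ count P? xs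
  count-filter-≤ Q? {xs} xs! = count-≤ (Unique.filter⁺ Q? xs!) (filter P? xs) λ e∈ Pe →
    ∈-filter⁺ P? (proj₁ (∈-filter⁻ Q? {xs = xs} e∈)) Pe

  count-map : (f : B → A) (xs : List B) → count P? (map f xs) ≡ count (P? ∘ f) xs
  count-map f []       = refl
  count-map f (x ∷ xs) with does (P? (f x))
  ... | true  = cong suc (count-map f xs)
  ... | false = count-map f xs

  -- The entries of `ys` fail `P`, so they are disjoint from those counted by `P`, and both kinds
  -- satisfy `Q`.
  count-mono-disjoint : {ys xs : List A} {Q : A → Set} (Q? : Decidable Q) →
    Unique ys → Unique xs →
    (∀ {e} → e ∈ ys → e ∈ xs × Q e × ¬ P e) → (∀ {e} → P e → Q e) →
    length ys + count P? xs ≤ count Q? xs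
  count-mono-disjoint {ys} {xs} Q? ys! xs! h P⇒Q = begin
    length ys + count P? xs       ≡⟨ length-++ ys ⟨
    length (ys ++ filter P? xs)   ≤⟨ unique-⊆⇒length-≤ ++! ⊆Q ⟩
    count Q? xs                   ∎
    where
    open ℕ.≤-Reasoning
    ++! : Unique (ys ++ filter P? xs)
    ++! = Unique.++⁺ ys! (Unique.filter⁺ P? xs!) λ (e∈ys , e∈P) →
      proj₂ (proj₂ (h e∈ys)) (proj₂ (∈-filter⁻ P? {xs = xs} e∈P))
    ⊆Q : ys ++ filter P? xs ⊆ filter Q? xs
    ⊆Q e∈ with ∈-++⁻ ys e∈
    ... | inj₁ e∈ys = let e∈xs , Qe , _ = h e∈ys in ∈-filter⁺ Q? e∈xs Qe
    ... | inj₂ e∈P  = let e∈xs , Pe = ∈-filter⁻ P? {xs = xs} e∈P in ∈-filter⁺ Q? e∈xs (P⇒Q Pe)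

-- Edge sets as 0-1 matrices, and transposition.

Edges : ℕ → ℕ → Set
Edges p q = List (Fin p × Fin q)

_∈?_ : (x : Fin p) (xs : List (Fin p)) → Dec (x ∈ xs)
_∈?_ = DecMembership._∈?_ Fin._≟_

_∈ₑ?_ : (e : Fin p × Fin q) (L : Edges p q) → Dec (e ∈ L)
_∈ₑ?_ = DecMembership._∈?_ (≡-dec Fin._≟_ Fin._≟_)

rows : List (Fin p) → Edges p q → ℕ
rows Rs = count λ e → proj₁ e ∈? Rs

cols : List (Fin q) → Edges p q → ℕ
cols Cs = count λ e → proj₂ e ∈? Cs

_ᵀ : Edges p q → Edges q p
_ᵀ = map swap

∈-ᵀ : {L : Edges p q} {e : Fin q × Fin p} → e ∈ L ᵀ → swap e ∈ L
∈-ᵀ e∈ with ∈-map⁻ swap e∈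
... | _ , e∈L , refl = e∈L

rows-ᵀ : (Cs : List (Fin q)) (L : Edges p q) → rows Cs (L ᵀ) ≡ cols Cs L
rows-ᵀ Cs = count-map (λ e → proj₁ e ∈? Cs) swap

cols-ᵀ : (Rs : List (Fin p)) (L : Edges p q) → cols Rs (L ᵀ) ≡ rows Rs L
cols-ᵀ Rs = count-map (λ e → proj₂ e ∈? Rs) swap

-- `R` and `C` list the rows and columns that survive deletion. They stay inside the fixed `Fin p`
-- and `Fin q`, so nothing is renumbered, and they may contain empty rows and columns, because
-- isolated vertices count as vertices.
record Drawing (L : Edges p q) (R : List (Fin p)) (C : List (Fin q)) : Set where
  field
    sortedᴿ : AllPairs _<_ R
    sortedᶜ : AllPairs _<_ C
    unique  : Unique L
    inside  : ∀ {i x} → (i , x) ∈ L → i ∈ R × x ∈ C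
    planar  : ∀ {e} → e ∈ L → count (cross? e) L ≤ 4

cross-swap : {e f : Fin p × Fin q} → Cross e f → Cross (swap e) (swap f)
cross-swap = Sum.swap ∘ Sum.map swap swap

transpose : {L : Edges p q} {R : List (Fin p)} {C : List (Fin q)} →
            Drawing L R C → Drawing (L ᵀ) C R
transpose {L = L} D = record
  { sortedᴿ = sortedᶜ
  ; sortedᶜ = sortedᴿ
  ; unique  = Unique.map⁺ (cong swap) unique
  ; inside  = swap ∘ inside ∘ ∈-ᵀ
  ; planar  = λ {e} e∈ → begin
      count (cross? e) (L ᵀ)       ≡⟨ count-map (cross? e) swap L ⟩
      count (cross? e ∘ swap) L    ≡⟨ cong length (filter-≐ (cross? e ∘ swap) (cross? (swap e))
                                        (cross-swap , cross-swap) L) ⟩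
      count (cross? (swap e)) L    ≤⟨ planar (∈-ᵀ e∈) ⟩
      4                            ∎
  }
  where
  open Drawing D
  open ℕ.≤-Reasoning

-- Initial segments of sorted lists.

sorted⇒unique : {xs : List (Fin p)} → AllPairs _<_ xs → Unique xs
sorted⇒unique = AllPairs.map Fin.<⇒≢

prefix-< : ∀ xs {ys : List (Fin p)} {x y} → AllPairs _<_ (xs ++ ys) →
           x ∈ xs → y ∈ ys → x < y
prefix-< (_ ∷ xs) (x< ∷ _) (here refl) y∈ = All.lookup x< (∈-++⁺ʳ xs y∈)
prefix-< (_ ∷ xs) (_ ∷ ss) (there x∈)  y∈ = prefix-< xs ss x∈ y∈

-- Turns a comparison with a leading row or column into membership in a short explicit list.
prefix-closed : ∀ xs {ys : List (Fin p)} {x y} → AllPairs _<_ (xs ++ ys) →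
                x ∈ xs → y Fin.≤ x → y ∈ xs ++ ys → y ∈ xs
prefix-closed xs ss x∈ y≤x y∈ with ∈-++⁻ xs y∈
... | inj₁ y∈xs = y∈xs
... | inj₂ y∈ys = contradiction (prefix-< xs ss x∈ y∈ys) (ℕ.≤⇒≯ y≤x)

sorted-++ˡ : ∀ xs {ys : List (Fin p)} → AllPairs _<_ (xs ++ ys) → AllPairs _<_ xs
sorted-++ˡ []       _         = []
sorted-++ˡ (x ∷ xs) (x< ∷ ss) =
  All.tabulate (λ y∈ → All.lookup x< (∈-++⁺ˡ y∈)) ∷ sorted-++ˡ xs ss

rows-≥ : {L : Edges p q} → Unique L → {Rs : List (Fin p)} → Unique Rs →
         (∀ {r} → r ∈ Rs → 3 ≤ rows [ r ] L) → length Rs * 3 ≤ rows Rs L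
rows-≥ _  [] _ = z≤n
rows-≥ {L = L} L! {r ∷ Rs} (r∉ ∷ Rs!) 3≤ = begin
  3 + length Rs * 3          ≤⟨ ℕ.+-mono-≤ (3≤ (here refl)) (rows-≥ L! Rs! (3≤ ∘ there)) ⟩
  rows [ r ] L + rows Rs L   ≤⟨ count-mono-disjoint (λ e → proj₁ e ∈? Rs) (λ e → proj₁ e ∈? (r ∷ Rs))
                                 (Unique.filter⁺ _ L!) L! sep there ⟩
  rows (r ∷ Rs) L            ∎
  where
  open ℕ.≤-Reasoning
  sep : ∀ {e} → e ∈ filter (λ e → proj₁ e ∈? [ r ]) L →
        e ∈ L × proj₁ e ∈ (r ∷ Rs) × proj₁ e ∉ Rs
  sep e∈ with ∈-filter⁻ (λ e → proj₁ e ∈? [ r ]) {xs = L} e∈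
  ... | e∈L , here refl = e∈L , here refl , λ r∈ → All.lookup r∉ r∈ refl

-- Crossings near the corner.

module _ {L : Edges p q} {R C} (D : Drawing L R C) where
  open Drawing D

  -- An edge in a row before s crosses (s , y) unless its column is at most y.
  crossing-bound : ∀ {s y Rs} Z → (s , y) ∈ L → (∀ {i} → i ∈ Rs → i < s) →
    (∀ {i x} → (i , x) ∈ L → i ∈ Rs → x Fin.≤ y → (i , x) ∈ Z) →
    rows Rs L ≤ 4 + length Z
  crossing-bound {s} {y} {Rs} Z e∈L Rs<s rest = begin
    rows Rs L                                  ≤⟨ count-≤ _ unique _ covered ⟩
    length (filter (cross? (s , y)) L ++ Z)    ≡⟨ length-++ (filter (cross? (s , y)) L) ⟩
    count (cross? (s , y)) L + length Z        ≤⟨ ℕ.+-monoˡ-≤ (length Z) (planar e∈L) ⟩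
    4 + length Z                               ∎
    where
    open ℕ.≤-Reasoning
    covered : ∀ {e} → e ∈ L → proj₁ e ∈ Rs → e ∈ filter (cross? (s , y)) L ++ Z
    covered {i , x} f∈L i∈ with x Fin.≤? y
    ... | yes x≤y = ∈-++⁺ʳ _ (rest f∈L i∈ x≤y)
    ... | no  x≰y = ∈-++⁺ˡ (∈-filter⁺ (cross? (s , y)) f∈L (inj₂ (Rs<s i∈ , ℕ.≰⇒> x≰y)))

-- The case in which no single row or column is cheap enough to delete.
record Corner (L : Edges p q) (R : List (Fin p)) (C : List (Fin q)) : Set where
  field
    drawing : Drawing L R C
    rows≥3  : ∀ {r} → r ∈ R → 3 ≤ rows [ r ] L
    cols≥3  : ∀ {c} → c ∈ C → 3 ≤ cols [ c ] L
  open Drawing drawing public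

transposeᶜ : {L : Edges p q} {R : List (Fin p)} {C : List (Fin q)} →
             Corner L R C → Corner (L ᵀ) C R
transposeᶜ {L = L} K = record
  { drawing = transpose drawing
  ; rows≥3  = λ {c} c∈ → subst (3 ≤_) (sym (rows-ᵀ [ c ] L)) (cols≥3 c∈)
  ; cols≥3  = λ {r} r∈ → subst (3 ≤_) (sym (cols-ᵀ [ r ] L)) (rows≥3 r∈)
  }
  where open Corner K

pattern 0# = here refl
pattern 1# = there (here refl)
pattern 2# = there (there (here refl))

module _ {L : Edges p q} {r₀ r₁ r₂ R′ c₀ C′}
         (K : Corner L (r₀ ∷ r₁ ∷ r₂ ∷ R′) (c₀ ∷ C′)) where
  open Corner K

  private
    Rs : List (Fin p)
    Rs = r₀ ∷ r₁ ∷ r₂ ∷ []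

    3rows : 9 ≤ rows Rs L
    3rows = rows-≥ unique {Rs} (sorted⇒unique (sorted-++ˡ Rs sortedᴿ)) (rows≥3 ∘ ∈-++⁺ˡ)

    block : ∀ {Rs i x} → (i , x) ∈ L → i ∈ Rs → x Fin.≤ c₀ →
            (i , x) ∈ cartesianProduct Rs [ c₀ ]
    block e∈ i∈ x≤ = ∈-cartesianProduct⁺ i∈
      (prefix-closed [ c₀ ] sortedᶜ (here refl) x≤ (proj₂ (inside e∈)))

    -- An entry of column `c₀` below row `r₂` would cross everything in the first three rows outside
    -- column `c₀`. These rows would have at most 4 + 3 = 7 entries, but they have at least 9.
    first-column-⊆ : ∀ {i} → (i , c₀) ∈ L → i ∈ Rs
    first-column-⊆ {i} e∈ with ∈-++⁻ Rs {R′} (proj₁ (inside e∈))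
    ... | inj₁ i∈ = i∈
    ... | inj₂ i∈ = contradiction
      (ℕ.≤-trans 3rows (crossing-bound drawing (cartesianProduct Rs [ c₀ ]) e∈
        (λ j∈ → prefix-< Rs sortedᴿ j∈ i∈) block))
      (from-no (9 ℕ.≤? 7))

  -- Column `c₀` has at least three entries, all in the first three rows, so none of these cells can
  -- be missing.
  first-column : ∀ {i} → i ∈ Rs → (i , c₀) ∈ L
  first-column {i} i∈ with (i , c₀) ∈ₑ? L
  ... | yes e∈ = e∈
  ... | no  e∉ = contradiction (ℕ.≤-trans (cols≥3 0#) (count-≤ _ unique _ covered))
      (ℕ.<⇒≱ (subst (ℕ._< 3) (sym (length-map (_, c₀) others))
        (filter-notAll ≢i? Rs (Any.map (λ i≡ ≢i → ≢i (sym i≡)) i∈))))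
    where
    ≢i? : Decidable (λ j → ¬ (j ≡ i))
    ≢i? j = ¬? (j Fin.≟ i)
    others : List (Fin p)
    others = filter ≢i? Rs
    covered : ∀ {e} → e ∈ L → proj₂ e ∈ [ c₀ ] → e ∈ map (_, c₀) others
    covered f∈ (here refl) = ∈-map⁺ (_, c₀)
      (∈-filter⁺ ≢i? (first-column-⊆ f∈) λ { refl → e∉ f∈ })

  -- The entry `(r₂ , c₀)` crosses all entries of rows `r₀` and `r₁` except the two in column `c₀`,
  -- whence 4 + 2.
  two-rows : rows (r₀ ∷ r₁ ∷ []) L ≤ 6
  two-rows = crossing-bound drawing (cartesianProduct (r₀ ∷ r₁ ∷ []) [ c₀ ]) (first-column 2#)
    (λ j∈ → prefix-< (r₀ ∷ r₁ ∷ []) sortedᴿ j∈ (here refl)) block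

module _ {L : Edges p q} {r₀ r₁ r₂ R′ c₀ c₁ C′}
         (K : Corner L (r₀ ∷ r₁ ∷ r₂ ∷ R′) (c₀ ∷ c₁ ∷ C′)) (r₁c₁∉L : (r₁ , c₁) ∉ L) where
  open Corner K

  private
    Rs : List (Fin p)
    Rs = r₀ ∷ r₁ ∷ r₂ ∷ []
    Cs : List (Fin q)
    Cs = c₀ ∷ c₁ ∷ []

  -- With `(r₁ , c₁)` missing, the first three rows supply at most two of the at least three entries
  -- of column `c₁`.
  beyond-corner : ∃[ s ] s ∈ R′ × (s , c₁) ∈ L
  beyond-corner with any? (λ e → (proj₁ e ∈? R′) ×-dec (proj₂ e Fin.≟ c₁)) L
  ... | yes any with find any
  ...   | (s , _) , e∈ , s∈ , refl = s , s∈ , e∈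
  beyond-corner | no ¬any = contradiction (ℕ.≤-trans (cols≥3 1#)
      (count-≤ _ unique ((r₀ , c₁) ∷ (r₂ , c₁) ∷ []) covered)) (from-no (3 ℕ.≤? 2))
    where
    covered : ∀ {e} → e ∈ L → proj₂ e ∈ [ c₁ ] → e ∈ (r₀ , c₁) ∷ (r₂ , c₁) ∷ []
    covered {_ , _} e∈ (here refl) with ∈-++⁻ Rs {R′} (proj₁ (inside e∈))
    ... | inj₁ 0# = 0#
    ... | inj₁ 1# = contradiction e∈ r₁c₁∉L
    ... | inj₁ 2# = 1#
    ... | inj₂ i∈ = contradiction (lose e∈ (i∈ , refl)) ¬any

  private
    -- The cells of the first three rows and two columns other than `(r₁ , c₁)` and `(r₂ , c₁)`. The
    -- latter is kept apart because its presence is still to be decided.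
    four : List (Fin p × Fin q)
    four = (r₀ , c₀) ∷ (r₀ , c₁) ∷ (r₁ , c₀) ∷ (r₂ , c₀) ∷ []

    block : ∀ {i x} → (i , x) ∈ L → i ∈ Rs → x Fin.≤ c₁ → (i , x) ∈ (r₂ , c₁) ∷ four
    block e∈ i∈ x≤ with i∈ | prefix-closed Cs sortedᶜ 1# x≤ (proj₂ (inside e∈))
    ... | 0# | 0# = 1#
    ... | 0# | 1# = 2#
    ... | 1# | 0# = there 2#
    ... | 1# | 1# = contradiction e∈ r₁c₁∉L
    ... | 2# | 0# = there (there 2#)
    ... | 2# | 1# = 0#

    bound : ∀ Z → (∀ {i x} → (i , x) ∈ L → i ∈ Rs → x Fin.≤ c₁ → (i , x) ∈ Z) →
            rows Rs L ≤ 4 + length Z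
    bound Z = let s , s∈ , e∈ = beyond-corner in
      crossing-bound drawing Z e∈ λ j∈ → prefix-< Rs sortedᴿ j∈ s∈

  -- The entry of `beyond-corner` crosses all entries of these rows to the right of `c₁`; at most
  -- five others remain, whence 4 + 5.
  three-rows : rows Rs L ≤ 9
  three-rows = bound ((r₂ , c₁) ∷ four) block

  -- Were it missing, the same crossing count would give 4 + 4 = 8, against at least 9 entries in
  -- three rows.
  r₂c₁∈L : (r₂ , c₁) ∈ L
  r₂c₁∈L with (r₂ , c₁) ∈ₑ? L
  ... | yes e∈ = e∈
  ... | no  e∉ = contradiction
      (ℕ.≤-trans (rows-≥ unique {Rs} (sorted⇒unique (sorted-++ˡ Rs sortedᴿ)) (rows≥3 ∘ ∈-++⁺ˡ))
        (bound four λ f∈ i∈ x≤ → drop f∈ (block f∈ i∈ x≤)))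
      (from-no (9 ℕ.≤? 8))
    where
    drop : ∀ {f} → f ∈ L → f ∈ (r₂ , c₁) ∷ four → f ∈ four
    drop f∈ (here refl) = contradiction f∈ e∉
    drop _  (there f∈)  = f∈

-- Deleting rows and columns.

module _ {L : Edges p q} (Rs : List (Fin p)) (Cs : List (Fin q)) where

  private
    Outside : Fin p × Fin q → Set
    Outside e = proj₁ e ∉ Rs × proj₂ e ∉ Cs

    outside? : Decidable Outside
    outside? e = ¬? (proj₁ e ∈? Rs) ×-dec ¬? (proj₂ e ∈? Cs)

    only-col? : Decidable λ (e : Fin p × Fin q) → proj₁ e ∉ Rs × proj₂ e ∈ Cs
    only-col? e = ¬? (proj₁ e ∈? Rs) ×-dec (proj₂ e ∈? Cs)

  prune : Edges p q
  prune = filter outside? L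

  -- Inclusion-exclusion: entries of `Z` lie in a deleted row and in a deleted column, so they are
  -- counted twice on the right.
  prune-length : Unique L → ∀ Z → Unique Z →
    (∀ {e} → e ∈ Z → e ∈ L × proj₁ e ∈ Rs × proj₂ e ∈ Cs) →
    length L + length Z ≤ rows Rs L + cols Cs L + length prune
  prune-length L! Z Z! Z⊆ = begin
    length L + length Z
      ≤⟨ ℕ.+-monoˡ-≤ (length Z) (unique-⊆⇒length-≤ L! split) ⟩
    length (inRow ++ onlyCol ++ prune) + length Z
      ≡⟨ cong (_+ length Z) (trans (length-++ inRow) (cong (rows Rs L +_) (length-++ onlyCol))) ⟩
    rows Rs L + (length onlyCol + length prune) + length Z
      ≡⟨ rearrange (rows Rs L) (length onlyCol) (length prune) (length Z) ⟩
    rows Rs L + (length Z + length onlyCol) + length prune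
      ≤⟨ ℕ.+-monoˡ-≤ (length prune) (ℕ.+-monoʳ-≤ (rows Rs L)
           (count-mono-disjoint only-col? (λ e → proj₂ e ∈? Cs) Z! L! inCol proj₂)) ⟩
    rows Rs L + cols Cs L + length prune ∎
    where
    open ℕ.≤-Reasoning
    inRow   = filter (λ e → proj₁ e ∈? Rs) L
    onlyCol = filter only-col? L
    inCol : ∀ {e} → e ∈ Z → e ∈ L × proj₂ e ∈ Cs × ¬ (proj₁ e ∉ Rs × proj₂ e ∈ Cs)
    inCol e∈ = let e∈L , i∈ , x∈ = Z⊆ e∈ in e∈L , x∈ , λ (i∉ , _) → i∉ i∈
    rearrange : ∀ a b c d → a + (b + c) + d ≡ a + (d + b) + c
    rearrange = solve-∀
    split : L ⊆ inRow ++ onlyCol ++ prune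
    split {e} e∈ with proj₁ e ∈? Rs | proj₂ e ∈? Cs
    ... | yes i∈ | _      = ∈-++⁺ˡ (∈-filter⁺ (λ e → proj₁ e ∈? Rs) e∈ i∈)
    ... | no i∉  | yes x∈ = ∈-++⁺ʳ inRow (∈-++⁺ˡ (∈-filter⁺ only-col? e∈ (i∉ , x∈)))
    ... | no i∉  | no x∉  = ∈-++⁺ʳ inRow (∈-++⁺ʳ onlyCol (∈-filter⁺ outside? e∈ (i∉ , x∉)))

  prune-drawing : ∀ {R C R′ C′} → Drawing L R C → AllPairs _<_ R′ → AllPairs _<_ C′ →
    (∀ {i} → i ∈ R → i ∉ Rs → i ∈ R′) → (∀ {x} → x ∈ C → x ∉ Cs → x ∈ C′) → Drawing prune R′ C′
  prune-drawing D sᴿ sᶜ R⊆ C⊆ = record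
    { sortedᴿ = sᴿ
    ; sortedᶜ = sᶜ
    ; unique  = Unique.filter⁺ outside? unique
    ; inside  = λ e∈ → let e∈L , i∉ , x∉ = ∈-filter⁻ outside? {xs = L} e∈
                           i∈ , x∈ = inside e∈L
                       in R⊆ i∈ i∉ , C⊆ x∈ x∉
    ; planar  = λ e∈ → ℕ.≤-trans (count-filter-≤ (cross? _) outside? unique)
                                 (planar (proj₁ (∈-filter⁻ outside? {xs = L} e∈)))
    }
    where open Drawing D

-- Adding 3 on the left avoids truncated subtraction.
Bounded : Edges p q → List (Fin p) → List (Fin q) → Set
Bounded L R C = length L + 3 ≤ 2 * (length R + length C)

bounded-ᵀ : {L : Edges p q} {R : List (Fin p)} {C : List (Fin q)} →
            Bounded (L ᵀ) C R → Bounded L R C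
bounded-ᵀ {L = L} {R} {C} =
  subst₂ (λ l n → l + 3 ≤ 2 * n) (length-map swap L) (ℕ.+-comm (length C) (length R))

module _ {L : Edges p q} {R C} (D : Drawing L R C) where
  open Drawing D

  -- The induction step: deleting `k` rows and columns lowers the bound by at least `2 * k`, and at
  -- most `2 * k` entries are lost once those in `Z` are counted only once.
  reduce : ∀ Rs Cs Z {R′ C′} → Unique Z →
    (∀ {e} → e ∈ Z → e ∈ L × proj₁ e ∈ Rs × proj₂ e ∈ Cs) →
    rows Rs L + cols Cs L ≤ length Z + 2 * (length Rs + length Cs) →
    AllPairs _<_ R′ → AllPairs _<_ C′ →
    (∀ {i} → i ∈ R → i ∉ Rs → i ∈ R′) → (∀ {x} → x ∈ C → x ∉ Cs → x ∈ C′) →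
    (length Rs + length Cs) + (length R′ + length C′) ≤ length R + length C →
    (∀ {L′} → Drawing L′ R′ C′ → Bounded L′ R′ C′) → Bounded L R C
  -- The length of `Z` is added to both sides and cancelled at the end, again to avoid subtraction.
  reduce Rs Cs Z {R′} {C′} Z! Z⊆ few sᴿ sᶜ R⊆ C⊆ k+m′≤m IH = ℕ.+-cancelʳ-≤ z _ _ (begin
    l + 3 + z                       ≡⟨ swap-right l 3 z ⟩
    l + z + 3                       ≤⟨ ℕ.+-monoˡ-≤ 3 (prune-length Rs Cs unique Z Z! Z⊆) ⟩
    rows Rs L + cols Cs L + l′ + 3  ≤⟨ ℕ.+-monoˡ-≤ 3 (ℕ.+-monoˡ-≤ l′ few) ⟩
    z + 2 * k + l′ + 3              ≡⟨ ℕ.+-assoc (z + 2 * k) l′ 3 ⟩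
    z + 2 * k + (l′ + 3)            ≤⟨ ℕ.+-monoʳ-≤ (z + 2 * k) (IH (prune-drawing Rs Cs D sᴿ sᶜ R⊆ C⊆)) ⟩
    z + 2 * k + 2 * m′              ≡⟨ collect z k m′ ⟩
    2 * (k + m′) + z                ≤⟨ ℕ.+-monoˡ-≤ z (ℕ.*-monoʳ-≤ 2 k+m′≤m) ⟩
    2 * (length R + length C) + z   ∎)
    where
    open ℕ.≤-Reasoning
    l  = length L
    l′ = length (prune {L = L} Rs Cs)
    z  = length Z
    k  = length Rs + length Cs
    m′ = length R′ + length C′
    swap-right : ∀ a b c → a + b + c ≡ a + c + b
    swap-right = solve-∀
    collect : ∀ a b c → a + 2 * b + 2 * c ≡ 2 * (b + c) + a
    collect = solve-∀

  reduce-low : ∀ {r} → r ∈ R → rows [ r ] L ≤ 2 →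
    (∀ {L′ R′} → length R′ ℕ.< length R → Drawing L′ R′ C → Bounded L′ R′ C) → Bounded L R C
  reduce-low {r} r∈ few IH = reduce [ r ] [] [] [] (λ ())
    (ℕ.+-mono-≤ few (count-≤ (λ e → proj₂ e ∈? []) unique [] (λ _ ())))
    (AllPairs.filter⁺ ≢r? sortedᴿ) sortedᶜ
    (λ i∈ i∉ → ∈-filter⁺ ≢r? i∈ (i∉ ∘ here)) (λ x∈ _ → x∈)
    (ℕ.+-monoˡ-≤ (length C) shorter) (IH shorter)
    where
    ≢r? : Decidable (λ i → ¬ (i ≡ r))
    ≢r? i = ¬? (i Fin.≟ r)
    shorter : length (filter ≢r? R) ℕ.< length R
    shorter = filter-notAll ≢r? R (Any.map (λ r≡ ≢r → ≢r (sym r≡)) r∈)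

-- Base case: at most two rows.

length-cartesianProduct : (xs : List A) (ys : List B) →
                          length (cartesianProduct xs ys) ≡ length xs * length ys
length-cartesianProduct []       ys = refl
length-cartesianProduct (x ∷ xs) ys = trans (length-++ (map (x ,_) ys))
  (cong₂ _+_ (length-map (x ,_) ys) (length-cartesianProduct xs ys))

-- Counting all cells of the grid is enough: `r * c + 3 ≤ 2 * (r + c)` when `r ≤ 2` and `2 ≤ r + c`,
-- with equality at `r = c = 1`.
few-rows : {L : Edges p q} {R : List (Fin p)} {C : List (Fin q)} → Drawing L R C →
           length R ≤ 2 → 2 ≤ length R + length C → Bounded L R C
few-rows {L = L} {R} {C} D R≤2 2≤ = ℕ.≤-trans (ℕ.+-monoˡ-≤ 3 L≤) (arith (length R) (length C) R≤2 2≤)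
  where
  open Drawing D
  L≤ : length L ≤ length R * length C
  L≤ = subst (length L ≤_) (length-cartesianProduct R C)
    (unique-⊆⇒length-≤ unique λ e∈ → let i∈ , x∈ = inside e∈ in ∈-cartesianProduct⁺ i∈ x∈)
  arith : ∀ r c → r ≤ 2 → 2 ≤ r + c → r * c + 3 ≤ 2 * (r + c)
  arith 0 c _ 2≤c = ℕ.≤-trans (ℕ.n≤1+n 3) (ℕ.*-monoʳ-≤ 2 2≤c)
  arith 1 c _ (s≤s 1≤c) = subst (1 * c + 3 ≤_) (rearrange c) (ℕ.+-monoʳ-≤ (1 * c) (s≤s (s≤s 1≤c)))
    where
    rearrange : ∀ c → 1 * c + (2 + c) ≡ 2 * (1 + c)
    rearrange = solve-∀
  arith 2 c _ _ = subst (2 * c + 3 ≤_) (rearrange c) (ℕ.+-monoʳ-≤ (2 * c) (ℕ.n≤1+n 3))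
    where
    rearrange : ∀ c → 2 * c + 4 ≡ 2 * (2 + c)
    rearrange = solve-∀
  arith (suc (suc (suc _))) _ (s≤s (s≤s ())) _

-- Deleting the corner.

∈-suffix : ∀ xs {ys : List A} {x} → x ∈ xs ++ ys → x ∉ xs → x ∈ ys
∈-suffix xs x∈ x∉ with ∈-++⁻ xs x∈
... | inj₁ x∈xs = contradiction x∈xs x∉
... | inj₂ x∈ys = x∈ys

module _ {L : Edges p q} {r₀ r₁ r₂ R′ c₀ c₁ c₂ C′}
         (K : Corner L (r₀ ∷ r₁ ∷ r₂ ∷ R′) (c₀ ∷ c₁ ∷ c₂ ∷ C′)) where
  open Corner K

  private
    Kᵀ = transposeᶜ K

    n = length (r₀ ∷ r₁ ∷ r₂ ∷ R′) + length (c₀ ∷ c₁ ∷ c₂ ∷ C′)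

  reduce-corner :
    (∀ {L″ R″ C″} → length R″ + length C″ ℕ.< n → 2 ≤ length R″ + length C″ →
      Drawing {p} {q} L″ R″ C″ → Bounded L″ R″ C″) →
    Bounded L (r₀ ∷ r₁ ∷ r₂ ∷ R′) (c₀ ∷ c₁ ∷ c₂ ∷ C′)
  reduce-corner IH with (r₁ , c₁) ∈ₑ? L
  ... | yes r₁c₁∈L = reduce drawing R₂ C₂ (cartesianProduct R₂ C₂) Z! Z⊆
      (ℕ.+-mono-≤ (two-rows K) (subst (_≤ 6) (rows-ᵀ C₂ L) (two-rows Kᵀ)))
      (AllPairs.tail (AllPairs.tail sortedᴿ)) (AllPairs.tail (AllPairs.tail sortedᶜ))
      (∈-suffix R₂) (∈-suffix C₂) (ℕ.≤-reflexive size)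
      (IH (ℕ.≤-trans (ℕ.+-monoˡ-≤ _ (s≤s (z≤n {3}))) (ℕ.≤-reflexive size)) (ℕ.+-mono-≤ {1} (s≤s z≤n) (s≤s z≤n)))
    where
    R₂ : List (Fin p)
    R₂ = r₀ ∷ r₁ ∷ []
    C₂ : List (Fin q)
    C₂ = c₀ ∷ c₁ ∷ []
    size : 4 + (length (r₂ ∷ R′) + length (c₂ ∷ C′)) ≡ n
    size = arith (length R′) (length C′)
      where
      arith : ∀ a b → 4 + ((1 + a) + (1 + b)) ≡ (3 + a) + (3 + b)
      arith = solve-∀
    Z! : Unique (cartesianProduct R₂ C₂)
    Z! = Unique.cartesianProduct⁺ (sorted⇒unique (sorted-++ˡ R₂ sortedᴿ))
                                  (sorted⇒unique (sorted-++ˡ C₂ sortedᶜ))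
    -- Column `c₀` and row `r₀` are full here, the row by transposition; the fourth cell is the case
    -- assumption.
    cell : ∀ {i x} → i ∈ R₂ → x ∈ C₂ → (i , x) ∈ L
    cell i∈ 0# = first-column K (∈-++⁺ˡ i∈)
    cell 0# 1# = ∈-ᵀ (first-column Kᵀ 1#)
    cell 1# 1# = r₁c₁∈L
    Z⊆ : ∀ {e} → e ∈ cartesianProduct R₂ C₂ → e ∈ L × proj₁ e ∈ R₂ × proj₂ e ∈ C₂
    Z⊆ e∈ = let i∈ , x∈ = ∈-cartesianProduct⁻ R₂ C₂ e∈ in cell i∈ x∈ , i∈ , x∈
  ... | no r₁c₁∉L = reduce drawing R₃ C₃ Z Z! Z⊆
      (ℕ.+-mono-≤ (three-rows K r₁c₁∉L)
        (subst (_≤ 9) (rows-ᵀ C₃ L) (three-rows Kᵀ (r₁c₁∉L ∘ ∈-ᵀ))))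
      (AllPairs.tail (AllPairs.tail (AllPairs.tail sortedᴿ)))
      (AllPairs.tail (AllPairs.tail (AllPairs.tail sortedᶜ)))
      (∈-suffix R₃) (∈-suffix C₃) (ℕ.≤-reflexive size)
      (IH (ℕ.≤-trans (ℕ.+-monoˡ-≤ _ (s≤s (z≤n {5}))) (ℕ.≤-reflexive size))
          -- The induction hypothesis needs two remaining rows or columns: `beyond-corner` provides
          -- a row in `R′` and, transposed, a column in `C′`.
          (ℕ.+-mono-≤ (∈-length (proj₁ (proj₂ (beyond-corner K r₁c₁∉L))))
                      (∈-length (proj₁ (proj₂ (beyond-corner Kᵀ (r₁c₁∉L ∘ ∈-ᵀ)))))))
    where
    R₃ : List (Fin p)
    R₃ = r₀ ∷ r₁ ∷ r₂ ∷ []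
    C₃ : List (Fin q)
    C₃ = c₀ ∷ c₁ ∷ c₂ ∷ []
    size : 6 + (length R′ + length C′) ≡ n
    size = arith (length R′) (length C′)
      where
      arith : ∀ a b → 6 + (a + b) ≡ (3 + a) + (3 + b)
      arith = solve-∀
    -- Six known entries of the 3 by 3 corner suffice, since 9 + 9 = 6 + 2 · 6. They form two
    -- products with disjoint columns, which makes `Z!` easy.
    Z₁ Z₂ Z : Edges p q
    Z₁ = cartesianProduct (r₀ ∷ r₂ ∷ []) (c₀ ∷ c₁ ∷ [])
    Z₂ = cartesianProduct (r₀ ∷ r₁ ∷ []) [ c₂ ]
    Z  = Z₁ ++ Z₂
    Z! : Unique Z
    Z! with sorted⇒unique sortedᴿ | sorted⇒unique sortedᶜ
    ... | (r₀≢r₁ ∷ r₀≢r₂ ∷ _) ∷ _ | (c₀≢c₁ ∷ c₀≢c₂ ∷ _) ∷ (c₁≢c₂ ∷ _) ∷ _ =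
      Unique.++⁺
        (Unique.cartesianProduct⁺ ((r₀≢r₂ ∷ []) ∷ [] ∷ []) ((c₀≢c₁ ∷ []) ∷ [] ∷ []))
        (Unique.cartesianProduct⁺ ((r₀≢r₁ ∷ []) ∷ [] ∷ []) ([] ∷ []))
        λ (e∈₁ , e∈₂) → disjoint
          (proj₂ (∈-cartesianProduct⁻ (r₀ ∷ r₂ ∷ []) (c₀ ∷ c₁ ∷ []) e∈₁))
          (proj₂ (∈-cartesianProduct⁻ (r₀ ∷ r₁ ∷ []) [ c₂ ] e∈₂))
      where
      disjoint : ∀ {x} → x ∈ c₀ ∷ c₁ ∷ [] → ¬ x ∈ [ c₂ ]
      disjoint 0# (here eq) = c₀≢c₂ eq
      disjoint 1# (here eq) = c₁≢c₂ eq
    Z⊆ : ∀ {e} → e ∈ Z → e ∈ L × proj₁ e ∈ R₃ × proj₂ e ∈ C₃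
    Z⊆ 0#                               = first-column K 0# , 0# , 0#
    Z⊆ 1#                               = ∈-ᵀ (first-column Kᵀ 1#) , 0# , 1#
    Z⊆ 2#                               = first-column K 2# , 2# , 0#
    Z⊆ (there 2#)                       = r₂c₁∈L K r₁c₁∉L , 2# , 1#
    Z⊆ (there (there 2#))               = ∈-ᵀ (first-column Kᵀ 2#) , 0# , 2#
    Z⊆ (there (there (there 2#)))       = ∈-ᵀ (r₂c₁∈L Kᵀ (r₁c₁∉L ∘ ∈-ᵀ)) , 1# , 2#

-- The induction.

-- The number `n` only bounds the total of rows and columns, since one step may delete one, four or
-- six of them.
bounded : ∀ n {L : Edges p q} {R C} → length R + length C ≤ n → 2 ≤ length R + length C →
          Drawing L R C → Bounded L R C
bounded 0       m≤0 2≤m _ = contradiction (ℕ.≤-trans 2≤m m≤0) λ ()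
bounded (suc n) {L} {R} {C} m≤ 2≤m D with length R ℕ.≤? 2 | length C ℕ.≤? 2
... | yes R≤2 | _       = few-rows D R≤2 2≤m
... | no _    | yes C≤2 = bounded-ᵀ {L = L} {R} {C}
  (few-rows (transpose D) C≤2 (subst (2 ≤_) (ℕ.+-comm (length R) (length C)) 2≤m))
... | no R≰2  | no C≰2
  with any? (λ r → rows [ r ] L ℕ.≤? 2) R | any? (λ c → cols [ c ] L ℕ.≤? 2) C
... | yes low | _ = let r , r∈ , few = find low in
  reduce-low D r∈ few λ R′< → bounded n
    (ℕ.s≤s⁻¹ (ℕ.≤-trans (ℕ.+-monoˡ-≤ (length C) R′<) m≤))
    -- The untouched columns, at least three, keep the total at two or more.
    (ℕ.≤-trans (ℕ.<⇒≤ (ℕ.≰⇒> C≰2)) (ℕ.m≤n+m (length C) _))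
... | no _ | yes low = let c , c∈ , few = find low in bounded-ᵀ {L = L} {R} {C}
  (reduce-low (transpose D) c∈ (subst (_≤ 2) (sym (rows-ᵀ [ c ] L)) few) λ C′< → bounded n
    (ℕ.s≤s⁻¹ (ℕ.≤-trans (ℕ.+-monoˡ-≤ (length R) C′<)
      (ℕ.≤-trans (ℕ.≤-reflexive (ℕ.+-comm (length C) (length R))) m≤)))
    (ℕ.≤-trans (ℕ.<⇒≤ (ℕ.≰⇒> R≰2)) (ℕ.m≤n+m (length R) _)))
bounded {p} {q} (suc n) {L} {R} {C} m≤ 2≤m D | no R≰2 | no C≰2 | no ¬lowᴿ | no ¬lowᶜ =
  at-corner R≰2 C≰2 record
    { drawing = D
    ; rows≥3  = λ r∈ → ℕ.≰⇒> λ few → ¬lowᴿ (lose r∈ few)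
    ; cols≥3  = λ c∈ → ℕ.≰⇒> λ few → ¬lowᶜ (lose c∈ few)
    } λ m′< → bounded n (ℕ.s≤s⁻¹ (ℕ.≤-trans m′< m≤))
  where
  at-corner : ∀ {R : List (Fin p)} {C : List (Fin q)} → ¬ length R ≤ 2 → ¬ length C ≤ 2 → Corner L R C →
    (∀ {L″ R″ C″} → length R″ + length C″ ℕ.< length R + length C → 2 ≤ length R″ + length C″ →
      Drawing {p} {q} L″ R″ C″ → Bounded L″ R″ C″) → Bounded L R C
  at-corner {_ ∷ _ ∷ _ ∷ _} {_ ∷ _ ∷ _ ∷ _} _ _ K IH = reduce-corner K IH
  at-corner {[]} R≰2 _ _ _ = contradiction z≤n R≰2
  at-corner {_ ∷ []} R≰2 _ _ _ = contradiction (s≤s z≤n) R≰2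
  at-corner {_ ∷ _ ∷ []} R≰2 _ _ _ = contradiction (s≤s (s≤s z≤n)) R≰2
  at-corner {_ ∷ _ ∷ _ ∷ _} {[]} _ C≰2 _ _ = contradiction z≤n C≰2
  at-corner {_ ∷ _ ∷ _ ∷ _} {_ ∷ []} _ C≰2 _ _ = contradiction (s≤s z≤n) C≰2
  at-corner {_ ∷ _ ∷ _ ∷ _} {_ ∷ _ ∷ []} _ C≰2 _ _ = contradiction (s≤s (s≤s z≤n)) C≰2

-- From drawings back to abstract graphs.

drawing : (D : TwoLayer p q) → IsPlanar 4 D → Drawing (drawnEdges D) (allFin p) (allFin q)
drawing {p} {q} D planar = record
  { sortedᴿ = AllPairs.tabulate⁺-< λ i<j → i<j
  ; sortedᶜ = AllPairs.tabulate⁺-< λ i<j → i<j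
  ; unique  = Unique.filter⁺ _ (Unique.cartesianProduct⁺ (Unique.allFin⁺ p) (Unique.allFin⁺ q))
  ; inside  = λ _ → ∈-allFin _ , ∈-allFin _
  ; planar  = λ {(i , x)} e∈ →
      planar i x (proj₂ (∈-filter⁻ _ {xs = cartesianProduct (allFin p) (allFin q)} e∈))
  }

-- Pulling drawn edges back along the isomorphism reaches every edge of `G`, and `edges G` has no
-- repetitions.
edgeCount-≤ : ∀ {n} (G : Graph (Fin n)) (D : TwoLayer p q) → G ≅ underlying D →
              edgeCount G ≤ length (drawnEdges D)
edgeCount-≤ {p} {q} {n} G D (f , adj⇔) =
  subst (edgeCount G ≤_) (length-map edge (drawnEdges D)) (unique-⊆⇒length-≤
    (Unique.filter⁺ _ (Unique.cartesianProduct⁺ (Unique.allFin⁺ n) (Unique.allFin⁺ n))) covered)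
  where
  open Inverse f

  -- The bijection need not respect order, so the endpoints are compared to put the smaller first,
  -- as `edges` does.
  edge : Fin p × Fin q → Fin n × Fin n
  edge (i , x) with from (inj₁ i) Fin.<? from (inj₂ x)
  ... | yes _ = from (inj₁ i) , from (inj₂ x)
  ... | no  _ = from (inj₂ x) , from (inj₁ i)

  edge-< : ∀ {a b i x} → a < b → to a ≡ inj₁ i → to b ≡ inj₂ x → edge (i , x) ≡ (a , b)
  edge-< {i = i} {x} a<b eqa eqb with inverseʳ (sym eqa) | inverseʳ (sym eqb)
  ... | refl | refl with from (inj₁ i) Fin.<? from (inj₂ x)
  ...   | yes _ = refl
  ...   | no ≮  = contradiction a<b ≮

  edge-> : ∀ {a b i x} → a < b → to b ≡ inj₁ i → to a ≡ inj₂ x → edge (i , x) ≡ (a , b)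
  edge-> {i = i} {x} a<b eqb eqa with inverseʳ (sym eqa) | inverseʳ (sym eqb)
  ... | refl | refl with from (inj₁ i) Fin.<? from (inj₂ x)
  ...   | yes lt = contradiction lt (Fin.<-asym a<b)
  ...   | no _   = refl

  drawn : ∀ {i x} → TwoLayer.E D i x → (i , x) ∈ drawnEdges D
  drawn e = ∈-filter⁺ _ (∈-cartesianProduct⁺ (∈-allFin _) (∈-allFin _)) e

  covered : edges G ⊆ map edge (drawnEdges D)
  covered {a , b} e∈ with ∈-filter⁻ _ {xs = cartesianProduct (allFin n) (allFin n)} e∈
  -- Vertices on the same line are never adjacent in `underlying D`, which leaves two cases.
  ... | _ , a<b , ab with to a in eqa | to b in eqb | Equivalence.to (adj⇔ a b) ab
  ...   | inj₁ i | inj₂ x | e = subst (_∈ _) (edge-< a<b eqa eqb) (∈-map⁺ edge (drawn e))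
  ...   | inj₂ x | inj₁ i | e = subst (_∈ _) (edge-> a<b eqb eqa) (∈-map⁺ edge (drawn e))

theorem6 : (n : ℕ) → 2 ≤ n → (G : Graph (Fin n)) → TwoLayerPlanar 4 G →
    edgeCount G ≤ 2 * n ∸ 3
theorem6 n 2≤n G (p , q , D , planar , iso@(f , _)) = begin
  edgeCount G              ≤⟨ edgeCount-≤ G D iso ⟩
  length (drawnEdges D)    ≤⟨ ℕ.m+n≤o⇒m≤o∸n _ (subst (λ m → length (drawnEdges D) + 3 ≤ 2 * m) size
                                (bounded _ ℕ.≤-refl (subst (2 ≤_) (sym size) 2≤n) (drawing D planar))) ⟩
  2 * n ∸ 3                ∎
  where
  open ℕ.≤-Reasoning
  -- The bijection between `Fin n` and `Fin p ⊎ Fin q` gives `n = p + q`.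
  size : length (allFin p) + length (allFin q) ≡ n
  size = trans (cong₂ _+_ (length-tabulate {n = p} (λ i → i)) (length-tabulate {n = q} (λ x → x)))
               (sym (↔⇒≡ (↔-sym Fin.+↔⊎ ↔-∘ f)))
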